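{- Let $G$ be a finite, simple, connected graph. Then $$\mathrm{Sz}^*(G) = \frac{1}{2} \sum_{u, v \in V(G)} \left( \mathrm{dis}_G(u, v) + \mathrm{deq}_G(u, u) - \frac{1}{2}\, \mathrm{deq}_G(u, v) \right),$$ where the sum runs over all ordered pairs $(u,v) \in V(G) \times V(G)$ (including $u = v$).
   Context: $V(G)$ and $E(G)$ are the vertex set and edge set of $G$; $d_G(u,v)$ is the distance (length of a shortest path) between $u$ and $v$ in $G$. For vertices $s,t$, $n_G(s,t)$ is the number of vertices $w$ of $G$ with $d_G(w,s) < d_G(w,t)$, and $o_G(s,t)$ is the number of vertices $w$ with $d_G(w,s) = d_G(w,t)$. The revised Szeged index is $$\mathrm{Sz}^*(G) = \sum_{\{s,t\} \in E(G)} \left(n_G(s,t) + \tfrac12 o_G(s,t)\right)\left(n_G(t,s) + \tfrac12 o_G(t,s)\right).$$ An edge $\{s,t\}$ is $(u,v)$-distance-disparate if either $d_G(u,s) < d_G(u,t)$ and $d_G(v,s) > d_G(v,t)$, or $d_G(u,s) > d_G(u,t)$ and $d_G(v,s) < d_G(v,t)$; $\mathrm{dis}_G(u,v)$ is the number of $(u,v)$-distance-disparate edges of $G$. An edge $\{s,t\}$ is $(u,v)$-distance-equal if $d_G(u,s) = d_G(u,t)$ and $d_G(v,s) = d_G(v,t)$; $\mathrm{deq}_G(u,v)$ is the number of $(u,v)$-distance-equal edges of $G$. -}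

module Defs where

open import Data.Fin.Base as Fin using (Fin)
import Data.Fin.Properties as Fin
open import Data.Integer.Base using (+_)
open import Data.List.Base using (List; []; _∷_; allFin; cartesianProduct; filter; foldr; length; map)
open import Data.List.Relation.Unary.Unique.Propositional using (Unique)
open import Data.List.Relation.Unary.Unique.DecPropositional using (unique?)
open import Data.Nat.Base using (ℕ; zero; suc; _<_; _>_; _≤_)
open import Data.Nat.Induction using (<-wellFounded)
open import Data.Nat.Properties using (_≟_; _<?_; ≮⇒≥; anyUpTo?)
open import Data.Product.Base using (Σ; Σ-syntax; _×_; _,_; proj₁)
open import Data.Rational.Base as ℚ using (ℚ; 0ℚ; ½)
open import Data.Sum.Base using (_⊎_)
open import Induction.WellFounded using (Acc; acc)
open import Level using (0ℓ)
open import Relation.Binary.Construct.Closure.ReflexiveTransitive using (Star; ε; _◅_)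
open import Relation.Binary.Core using (Rel)
import Relation.Binary.Definitions as B
open import Relation.Binary.PropositionalEquality using (_≡_; refl; cong)
open import Relation.Nullary using (Dec; yes; no)
open import Relation.Nullary.Decidable using (map′; _×-dec_; _⊎-dec_)
open import Relation.Unary using (Pred; Decidable)

record Graph (n : ℕ) : Set₁ where
  field
    Adj     : Rel (Fin n) 0ℓ
    adj?    : B.Decidable Adj
    sym     : B.Symmetric Adj
    irrefl  : B.Irreflexive _≡_ Adj

module _ {n : ℕ} (G : Graph n) where
  open Graph G

  Walk : Rel (Fin n) 0ℓ
  Walk = Star Adj

  walkLength : ∀ {u v} → Walk u v → ℕ
  walkLength ε       = 0
  walkLength (_ ◅ w) = suc (walkLength w)

  vertices : ∀ {u v} → Walk u v → List (Fin n)
  vertices {u} ε       = u ∷ []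
  vertices {u} (_ ◅ w) = u ∷ vertices w

  Path : Rel (Fin n) 0ℓ
  Path u v = Σ[ w ∈ Walk u v ] Unique (vertices w)

  pathLength : ∀ {u v} → Path u v → ℕ
  pathLength (w , _) = walkLength w

  Connected : Set
  Connected = ∀ u v → Path u v

  IsShortest : ∀ {u v} → Path u v → Set
  IsShortest {u} {v} p = (q : Path u v) → pathLength p ≤ pathLength q

  -- Each edge {s , t} is represented once, by the pair (s , t) with s < t.
  -- Everything summed or counted over edges below is symmetric in s and t.
  edges : List (Fin n × Fin n)
  edges = filter (λ (s , t) → s Fin.<? t ×-dec adj? s t)
                 (cartesianProduct (allFin n) (allFin n))

  -- Generalised over P so that the recursion can carry the condition on the
  -- whole vertex list.
  walkOfLength? : {P : Pred (List (Fin n)) 0ℓ} → Decidable P → ∀ k u v →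
                  Dec (Σ[ w ∈ Walk u v ] walkLength w ≡ k × P (vertices w))
  walkOfLength? {P} P? zero u v with u Fin.≟ v
  ... | no u≢v   = no λ { (ε , _) → u≢v refl ; (_ ◅ _ , () , _) }
  ... | yes refl = map′ (λ p → ε , refl , p)
                        (λ { (ε , _ , p) → p ; (_ ◅ _ , () , _) })
                        (P? (u ∷ []))
  walkOfLength? {P} P? (suc k) u v =
    map′ (λ { (_ , e , w , refl , p) → e ◅ w , refl , p })
         (λ { (ε , () , _) ; (e ◅ w , refl , p) → _ , e , w , refl , p })
         (Fin.any? λ x → adj? u x ×-dec walkOfLength? (λ vs → P? (u ∷ vs)) k x v)

  pathOfLength? : ∀ u v k → Dec (Σ[ p ∈ Path u v ] pathLength p ≡ k)
  pathOfLength? u v k =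
    map′ (λ { (w , eq , uniq) → (w , uniq) , eq })
         (λ { ((w , uniq) , eq) → w , eq , uniq })
         (walkOfLength? (unique? Fin._≟_) k u v)

  shortestPath : ∀ {u v} → Path u v → Σ (Path u v) IsShortest
  shortestPath {u} {v} p = go p (<-wellFounded (pathLength p))
    where
    go : (p : Path u v) → Acc _<_ (pathLength p) → Σ (Path u v) IsShortest
    go p (acc rec) with anyUpTo? (pathOfLength? u v) (pathLength p)
    ... | yes (_ , q<p , q , refl) = go q (rec q<p)
    ... | no  none = p , λ q → ≮⇒≥ λ q<p → none (_ , q<p , q , refl)

count : ∀ {A : Set} {P : Pred A 0ℓ} → Decidable P → List A → ℕ
count P? xs = length (filter P? xs)

fromℕ : ℕ → ℚ
fromℕ m = + m ℚ./ 1

∑ : ∀ {A : Set} → List A → (A → ℚ) → ℚ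
∑ xs f = foldr ℚ._+_ 0ℚ (map f xs)

-- Connectedness is what makes the distance a total ℕ-valued function; its
-- value does not depend on the chosen proof, as all shortest paths between
-- two vertices have the same length.
module Distance {n : ℕ} (G : Graph n) (conn : Connected G) where

  d : Fin n → Fin n → ℕ
  d u v = pathLength G (proj₁ (shortestPath G (conn u v)))

  closer : Fin n → Fin n → ℕ
  closer s t = count (λ w → d w s <? d w t) (allFin n)

  equidistant : Fin n → Fin n → ℕ
  equidistant s t = count (λ w → d w s ≟ d w t) (allFin n)

  Sz* : ℚ
  Sz* = ∑ (edges G) λ (s , t) →
    (fromℕ (closer s t) ℚ.+ ½ ℚ.* fromℕ (equidistant s t)) ℚ.*
    (fromℕ (closer t s) ℚ.+ ½ ℚ.* fromℕ (equidistant t s))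

  Disparate : Fin n → Fin n → Pred (Fin n × Fin n) 0ℓ
  Disparate u v (s , t) = (d u s < d u t × d v s > d v t)
                        ⊎ (d u s > d u t × d v s < d v t)

  disparate? : ∀ u v → Decidable (Disparate u v)
  disparate? u v (s , t) = (d u s <? d u t ×-dec d v t <? d v s)
                     ⊎-dec (d u t <? d u s ×-dec d v s <? d v t)

  DistanceEqual : Fin n → Fin n → Pred (Fin n × Fin n) 0ℓ
  DistanceEqual u v (s , t) = d u s ≡ d u t × d v s ≡ d v t

  distanceEqual? : ∀ u v → Decidable (DistanceEqual u v)
  distanceEqual? u v (s , t) = d u s ≟ d u t ×-dec d v s ≟ d v t

  dis : Fin n → Fin n → ℕ
  dis u v = count (disparate? u v) (edges G)

  deq : Fin n → Fin n → ℕ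
  deq u v = count (distanceEqual? u v) (edges G)

-- Split the vertices by their position relative to an edge {s , t}: let A be
-- the number closer to s, B the number closer to t and C the number
-- equidistant from both. Over all ordered pairs (u , v) the edge is disparate
-- 2AB times, equal for (u , u) in (A + B + C)C cases and equal for (u , v) in
-- C² cases, so its share of the right-hand side is
-- ½ (2AB + (A + B + C)C − ½C²) = (A + ½C)(B + ½C).
module Submission where

open import Defs
open import Data.Bool.Base using (Bool; true; false; if_then_else_)
open import Data.Fin.Base using (Fin)
import Data.Integer.Base as ℤ
import Data.Integer.Properties as ℤ
open import Data.List.Base using (List; []; _∷_; allFin)
open import Data.Nat.Base using (ℕ; suc)
open import Data.Nat.Properties using (_≟_; _<?_; <-asym; <-cmp)
open import Data.Product.Base using (_×_; _,_)
open import Data.Rational.Base using (ℚ; 0ℚ; 1ℚ; ½; -½; _+_; _-_; _*_; toℚᵘ)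
open import Data.Rational.Properties hiding (_≟_; _<?_; <-asym; <-cmp; module ≤-Reasoning)
open import Data.Rational.Solver using (module +-*-Solver)
open import Data.Rational.Unnormalised.Base as ℚᵘ using (mkℚᵘ; 1ℚᵘ; *≡*)
import Data.Rational.Unnormalised.Properties as ℚᵘ
open import Function.Bundles using (mk⇔)
open import Level using (0ℓ)
open import Relation.Binary.Definitions using (tri<; tri≈; tri>)
open import Relation.Binary.PropositionalEquality using (_≡_; refl; sym; trans; cong; cong₂; module ≡-Reasoning)
open import Relation.Nullary using (¬_; Dec; does; yes; no; contradiction)
open import Relation.Nullary.Decidable using (_×-dec_; _⊎-dec_; dec-true; dec-false; does-⇔)
open import Relation.Unary using (Pred; Decidable)

open ≡-Reasoning
open +-*-Solver using (solve; _:+_; _:-_; _:*_; _:=_; con)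

private variable
  A B : Set
  P Q : Set

∑-cong : ∀ (xs : List A) {f g : A → ℚ} → (∀ x → f x ≡ g x) → ∑ xs f ≡ ∑ xs g
∑-cong []       f≡g = refl
∑-cong (x ∷ xs) f≡g = cong₂ _+_ (f≡g x) (∑-cong xs f≡g)

∑-+ : ∀ (xs : List A) (f g : A → ℚ) → ∑ xs (λ x → f x + g x) ≡ ∑ xs f + ∑ xs g
∑-+ []       f g = refl
∑-+ (x ∷ xs) f g = trans (cong (f x + g x +_) (∑-+ xs f g))
  (solve 4 (λ a b c d → (a :+ b) :+ (c :+ d) := (a :+ c) :+ (b :+ d)) refl (f x) (g x) (∑ xs f) (∑ xs g))

∑-*ˡ : ∀ (xs : List A) c (f : A → ℚ) → ∑ xs (λ x → c * f x) ≡ c * ∑ xs f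
∑-*ˡ []       c f = sym (*-zeroʳ c)
∑-*ˡ (x ∷ xs) c f = trans (cong (c * f x +_) (∑-*ˡ xs c f)) (sym (*-distribˡ-+ c (f x) (∑ xs f)))

∑-*ʳ : ∀ (xs : List A) c (f : A → ℚ) → ∑ xs (λ x → f x * c) ≡ ∑ xs f * c
∑-*ʳ []       c f = sym (*-zeroˡ c)
∑-*ʳ (x ∷ xs) c f = trans (cong (f x * c +_) (∑-*ʳ xs c f)) (sym (*-distribʳ-+ c (f x) (∑ xs f)))

∑-0 : ∀ (xs : List A) → ∑ xs (λ _ → 0ℚ) ≡ 0ℚ
∑-0 []       = refl
∑-0 (x ∷ xs) = trans (+-identityˡ _) (∑-0 xs)

∑-swap : ∀ (xs : List A) (ys : List B) (f : A → B → ℚ) →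
         ∑ xs (λ x → ∑ ys (f x)) ≡ ∑ ys (λ y → ∑ xs (λ x → f x y))
∑-swap []       ys f = sym (∑-0 ys)
∑-swap (x ∷ xs) ys f = trans (cong (∑ ys (f x) +_) (∑-swap xs ys f)) (sym (∑-+ ys (f x) _))

∑-product : ∀ (xs : List A) (ys : List B) (f : A → ℚ) (g : B → ℚ) →
            ∑ xs (λ x → ∑ ys (λ y → f x * g y)) ≡ ∑ xs f * ∑ ys g
∑-product xs ys f g = trans (∑-cong xs λ x → ∑-*ˡ ys (f x) g) (∑-*ʳ xs (∑ ys g) f)

-- `fromℕ` reduces its fraction to lowest terms, which does not compute for a variable `m`. In the
-- unnormalised rationals the sum is an explicit fraction, and only a factor 1 in the numerator
-- remains to be cancelled.
fromℕ-suc : ∀ m → fromℕ (suc m) ≡ 1ℚ + fromℕ m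
fromℕ-suc m = toℚᵘ-injective (begin≃
  toℚᵘ (fromℕ (suc m))           ≈⟨ toℚᵘ-fromℚᵘ (mkℚᵘ (ℤ.+ suc m) 0) ⟩
  mkℚᵘ (ℤ.+ suc m) 0             ≈⟨ *≡* (cong (λ k → (ℤ.1ℤ ℤ.+ k) ℤ.* ℤ.1ℤ) (sym (ℤ.*-identityʳ (ℤ.+ m)))) ⟩
  1ℚᵘ ℚᵘ.+ mkℚᵘ (ℤ.+ m) 0        ≈⟨ ℚᵘ.+-congʳ 1ℚᵘ (toℚᵘ-fromℚᵘ (mkℚᵘ (ℤ.+ m) 0)) ⟨
  toℚᵘ 1ℚ ℚᵘ.+ toℚᵘ (fromℕ m)    ≈⟨ toℚᵘ-homo-+ 1ℚ (fromℕ m) ⟨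
  toℚᵘ (1ℚ + fromℕ m)            ∎≃)
  where
  open ℚᵘ.≃-Reasoning using (step-≈-⟩; step-≈-⟨) renaming (begin_ to begin≃_; _∎ to _∎≃)

bit : Bool → ℚ
bit b = if b then 1ℚ else 0ℚ

⟦_⟧ : Dec P → ℚ
⟦ p? ⟧ = bit (does p?)

-- Cardinalities become sums of indicators, so that products of counts turn into double sums and
-- orders of summation can be exchanged.
fromℕ-count : ∀ {P : Pred A 0ℓ} (P? : Decidable P) xs →
              fromℕ (count P? xs) ≡ ∑ xs (λ x → ⟦ P? x ⟧)
fromℕ-count P? []       = refl
fromℕ-count P? (x ∷ xs) with does (P? x)
... | true  = trans (fromℕ-suc (count P? xs)) (cong (1ℚ +_) (fromℕ-count P? xs))
... | false = trans (fromℕ-count P? xs) (sym (+-identityˡ _))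

⟦×⟧ : (p? : Dec P) (q? : Dec Q) → ⟦ p? ×-dec q? ⟧ ≡ ⟦ p? ⟧ * ⟦ q? ⟧
⟦×⟧ (yes _) q? = sym (*-identityˡ ⟦ q? ⟧)
⟦×⟧ (no  _) q? = sym (*-zeroˡ ⟦ q? ⟧)

-- Disjointness excludes the one case in which the right-hand side would be 2.
⟦⊎⟧ : (p? : Dec P) (q? : Dec Q) → (P → ¬ Q) → ⟦ p? ⊎-dec q? ⟧ ≡ ⟦ p? ⟧ + ⟦ q? ⟧
⟦⊎⟧ (yes p) (yes q) disjoint = contradiction q (disjoint p)
⟦⊎⟧ (yes _) (no  _) _        = refl
⟦⊎⟧ (no  _) q?      _        = sym (+-identityˡ ⟦ q? ⟧)

⟦⟧-cong : (p? : Dec P) (q? : Dec Q) → (P → Q) → (Q → P) → ⟦ p? ⟧ ≡ ⟦ q? ⟧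
⟦⟧-cong p? q? to from = cong bit (does-⇔ (mk⇔ to from) p? q?)

-- Serves to insert a factor 1: a term that depends on one vertex only can then be expanded over the
-- position of a second vertex.
⟦⟧-tri : ∀ m k → ⟦ m <? k ⟧ + ⟦ k <? m ⟧ + ⟦ m ≟ k ⟧ ≡ 1ℚ
⟦⟧-tri m k with <-cmp m k
... | tri< a ¬b ¬c rewrite dec-true (m <? k) a | dec-false (m ≟ k) ¬b | dec-false (k <? m) ¬c = refl
... | tri≈ ¬a b ¬c rewrite dec-false (m <? k) ¬a | dec-true (m ≟ k) b | dec-false (k <? m) ¬c = refl
... | tri> ¬a ¬b c rewrite dec-false (m <? k) ¬a | dec-false (m ≟ k) ¬b | dec-true (k <? m) c = refl

module _ {n : ℕ} (G : Graph n) (conn : Connected G) where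
  open Distance G conn

  -- The contribution of the single edge `e` to the term of the pair `(u , v)`; isolating it lets
  -- the sum over edges be moved outermost.
  summand : Fin n → Fin n → Fin n × Fin n → ℚ
  summand u v e = ⟦ disparate? u v e ⟧ + ⟦ distanceEqual? u u e ⟧ - ½ * ⟦ distanceEqual? u v e ⟧

  ∑-summand : ∀ u v → fromℕ (dis u v) + fromℕ (deq u u) - ½ * fromℕ (deq u v)
                      ≡ ∑ (edges G) (summand u v)
  ∑-summand u v = begin
    fromℕ (dis u v) + fromℕ (deq u u) - ½ * fromℕ (deq u v)
      ≡⟨ cong₂ (λ x y → x - ½ * y)
           (cong₂ _+_ (fromℕ-count (disparate? u v) E) (fromℕ-count (distanceEqual? u u) E))
           (fromℕ-count (distanceEqual? u v) E) ⟩
    ∑ E f + ∑ E g - ½ * ∑ E h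
      -- Subtraction unfolds to adding a negative; absorbing the sign into the coefficient `-½`
      -- makes the additivity and scaling of `∑` applicable.
      ≡⟨ cong₂ _+_ (sym (∑-+ E f g)) (trans (neg-distribˡ-* ½ (∑ E h)) (sym (∑-*ˡ E -½ h))) ⟩
    ∑ E (λ e → f e + g e) + ∑ E (λ e → -½ * h e)
      ≡⟨ ∑-+ E (λ e → f e + g e) (λ e → -½ * h e) ⟨
    ∑ E (λ e → f e + g e + -½ * h e)
      ≡⟨ ∑-cong E (λ e → cong (f e + g e +_) (neg-distribˡ-* ½ (h e))) ⟨
    ∑ E (summand u v) ∎
    where
    E = edges G
    f g h : Fin n × Fin n → ℚ
    f e = ⟦ disparate? u v e ⟧
    g e = ⟦ distanceEqual? u u e ⟧
    h e = ⟦ distanceEqual? u v e ⟧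

  module _ (s t : Fin n) where

    nearS nearT same : Fin n → ℚ
    nearS w = ⟦ d w s <? d w t ⟧
    nearT w = ⟦ d w t <? d w s ⟧
    same  w = ⟦ d w s ≟ d w t ⟧

    -- ⟦ distanceEqual? u u (s , t) ⟧ = same u, expanded over the trichotomy of v.
    summand-split : ∀ u v → summand u v (s , t) ≡
      nearS u * nearT v + nearT u * nearS v + same u * (nearS v + nearT v + ½ * same v)
    summand-split u v = begin
      ⟦ disparate? u v (s , t) ⟧ + ⟦ distanceEqual? u u (s , t) ⟧ - ½ * ⟦ distanceEqual? u v (s , t) ⟧
        ≡⟨ cong₂ (λ x y → x - ½ * y) (cong₂ _+_ dis≡ deq≡)
             (⟦×⟧ (d u s ≟ d u t) (d v s ≟ d v t)) ⟩
      nearS u * nearT v + nearT u * nearS v + same u * (nearS v + nearT v + same v) - ½ * (same u * same v)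
        ≡⟨ solve 6 (λ a b c x y z →
             a :* y :+ b :* x :+ c :* (x :+ y :+ z) :- con ½ :* (c :* z) :=
             a :* y :+ b :* x :+ c :* (x :+ y :+ con ½ :* z)) refl
             (nearS u) (nearT u) (same u) (nearS v) (nearT v) (same v) ⟩
      nearS u * nearT v + nearT u * nearS v + same u * (nearS v + nearT v + ½ * same v) ∎
      where
      dis≡ : ⟦ disparate? u v (s , t) ⟧ ≡ nearS u * nearT v + nearT u * nearS v
      dis≡ = trans
        -- The two alternatives exclude each other already through `u`, which cannot be strictly
        -- closer to both ends.
        (⟦⊎⟧ (d u s <? d u t ×-dec d v t <? d v s) (d u t <? d u s ×-dec d v s <? d v t)
             λ (us<ut , _) (ut<us , _) → <-asym us<ut ut<us)
        (cong₂ _+_ (⟦×⟧ (d u s <? d u t) (d v t <? d v s)) (⟦×⟧ (d u t <? d u s) (d v s <? d v t)))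

      deq≡ : ⟦ distanceEqual? u u (s , t) ⟧ ≡ same u * (nearS v + nearT v + same v)
      deq≡ = begin
        ⟦ distanceEqual? u u (s , t) ⟧
          ≡⟨ ⟦⟧-cong (distanceEqual? u u (s , t)) (d u s ≟ d u t) (λ (eq , _) → eq) (λ eq → eq , eq) ⟩
        same u
          ≡⟨ *-identityʳ (same u) ⟨
        same u * 1ℚ
          ≡⟨ cong (same u *_) (⟦⟧-tri (d v s) (d v t)) ⟨
        same u * (nearS v + nearT v + same v) ∎

    edge-identity :
      (fromℕ (closer s t) + ½ * fromℕ (equidistant s t)) * (fromℕ (closer t s) + ½ * fromℕ (equidistant t s))
      ≡ ½ * ∑ (allFin n) (λ u → ∑ (allFin n) (λ v → summand u v (s , t)))
    edge-identity = begin
      (fromℕ (closer s t) + ½ * fromℕ (equidistant s t)) * (fromℕ (closer t s) + ½ * fromℕ (equidistant t s))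
        ≡⟨ cong₂ _*_
             (cong₂ (λ x y → x + ½ * y) (fromℕ-count _ V) (fromℕ-count _ V))
             (cong₂ (λ x y → x + ½ * y) (fromℕ-count _ V)
               -- `equidistant t s` tests the reversed equation; symmetry of `≡` turns it into
               -- `same`, so both factors contain the same `C`.
               (trans (fromℕ-count _ V)
                 (∑-cong V λ w → ⟦⟧-cong (d w t ≟ d w s) (d w s ≟ d w t) sym sym))) ⟩
      (S + ½ * C) * (T + ½ * C)
        -- 2AB is kept as two products, one for each alternative of `Disparate`, and C is factored
        -- out of (A + B + C)C - ½C².
        ≡⟨ solve 3 (λ a b c → (a :+ con ½ :* c) :* (b :+ con ½ :* c) :=
             con ½ :* (a :* b :+ b :* a :+ c :* (a :+ b :+ con ½ :* c))) refl S T C ⟩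
      ½ * (S * T + T * S + C * (S + T + ½ * C))
        ≡⟨ cong (½ *_) double-sum ⟨
      ½ * ∑ V (λ u → ∑ V (λ v → summand u v (s , t))) ∎
      where
      V = allFin n
      -- `S`, `T` and `C` are the numbers A, B and C of the overview.
      S = ∑ V nearS
      T = ∑ V nearT
      C = ∑ V same

      rest : Fin n → ℚ
      rest v = nearS v + nearT v + ½ * same v

      ∑-rest : ∑ V rest ≡ S + T + ½ * C
      ∑-rest = trans (∑-+ V (λ v → nearS v + nearT v) (λ v → ½ * same v))
                     (cong₂ _+_ (∑-+ V nearS nearT) (∑-*ˡ V ½ same))

      ∑∑-+ : ∀ (f g : Fin n → Fin n → ℚ) → ∑ V (λ u → ∑ V (λ v → f u v + g u v)) ≡
             ∑ V (λ u → ∑ V (f u)) + ∑ V (λ u → ∑ V (g u))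
      ∑∑-+ f g = trans (∑-cong V λ u → ∑-+ V (f u) (g u)) (∑-+ V _ _)

      -- After `summand-split` each of the three terms is a function of `u` times a function of `v`,
      -- so its double sum factors into two single sums.
      double-sum : ∑ V (λ u → ∑ V (λ v → summand u v (s , t))) ≡
                   S * T + T * S + C * (S + T + ½ * C)
      double-sum = begin
        ∑ V (λ u → ∑ V (λ v → summand u v (s , t)))
          ≡⟨ ∑-cong V (λ u → ∑-cong V (summand-split u)) ⟩
        ∑ V (λ u → ∑ V (λ v → nearS u * nearT v + nearT u * nearS v + same u * rest v))
          ≡⟨ trans (∑∑-+ _ _) (cong₂ _+_ (∑∑-+ _ _) refl) ⟩
        ∑ V (λ u → ∑ V (λ v → nearS u * nearT v)) + ∑ V (λ u → ∑ V (λ v → nearT u * nearS v))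
          + ∑ V (λ u → ∑ V (λ v → same u * rest v))
          ≡⟨ cong₂ _+_ (cong₂ _+_ (∑-product V V nearS nearT) (∑-product V V nearT nearS))
               (trans (∑-product V V same rest) (cong (C *_) ∑-rest)) ⟩
        S * T + T * S + C * (S + T + ½ * C) ∎

theorem2p1 : ∀ {n : ℕ} (G : Graph n) (conn : Connected G) →
    let open Distance G conn in
    Sz* ≡ ½ * ∑ (allFin n) (λ u → ∑ (allFin n) (λ v →
    fromℕ (dis u v) + fromℕ (deq u u) - ½ * fromℕ (deq u v)))
theorem2p1 {n} G conn = begin
  Sz*
    ≡⟨ ∑-cong E (λ (s , t) → edge-identity G conn s t) ⟩
  ∑ E (λ e → ½ * ∑ V (λ u → ∑ V (λ v → F u v e)))
    ≡⟨ ∑-*ˡ E ½ _ ⟩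
  ½ * ∑ E (λ e → ∑ V (λ u → ∑ V (λ v → F u v e)))
    -- The edge sum moves inward, past `u` here and past `v` in the next step, where `∑-summand`
    -- reassembles the counts for each pair.
    ≡⟨ cong (½ *_) (∑-swap V E (λ u e → ∑ V (λ v → F u v e))) ⟨
  ½ * ∑ V (λ u → ∑ E (λ e → ∑ V (λ v → F u v e)))
    ≡⟨ cong (½ *_) (∑-cong V λ u → trans
         (∑-cong V (∑-summand G conn u)) (∑-swap V E (F u))) ⟨
  ½ * ∑ V (λ u → ∑ V (λ v → fromℕ (dis u v) + fromℕ (deq u u) - ½ * fromℕ (deq u v))) ∎
  where
  open Distance G conn
  E = edges G
  V = allFin n
  F = summand G conn
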